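{- The universe $\mathcal E$ of dead-ending games has the conjugate property: for all $G,H\in\mathcal E$, if $G+H\equiv_{\mathcal E}\mathbf 0$ then $H\equiv_{\mathcal E}\overline G$.
   Context: All games are short two-player partizan games between Left and Right, identified with their game trees: $G=\{G^{\mathcal L}\mid G^{\mathcal R}\}$ with finite sets of options; $\mathbf 0=\{\;\mid\;\}$. Followers of $G$: $G$, its options, their options, etc. Disjunctive sum: $G+H=\{G^{\mathcal L}+H,G+H^{\mathcal L}\mid G^{\mathcal R}+H,G+H^{\mathcal R}\}$. Conjugate: $\overline G=\{\overline{G^{\mathcal R}}\mid\overline{G^{\mathcal L}}\}$ (recursively). Misère play: a player with no move on their turn wins. $o_L(G)=\mathrm L$ if $G^{\mathcal L}=\emptyset$, else $\max_{G^L}o_R(G^L)$; $o_R(G)=\mathrm R$ if $G^{\mathcal R}=\emptyset$, else $\min_{G^R}o_L(G^R)$; $\mathrm L>\mathrm R$; $o(G)=(o_L(G),o_R(G))$ ordered componentwise. A Left-end has no Left option; a dead Left-end has only Left-ends as followers; similarly Right. A game is dead-ending if each follower that is a Left-end (Right-end) is a dead Left-end (dead Right-end); $\mathcal E$ is the class of dead-ending games. $G\geq_{\mathcal E}H$ means $o(G+X)\geq o(H+X)$ for all $X\in\mathcal E$; $G\equiv_{\mathcal E}H$ means both $G\geq_{\mathcal E}H$ and $H\geq_{\mathcal E}G$. -}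

module Defs where

open import Data.List using (List; []; _∷_; _++_)
open import Data.List.Membership.Propositional using (_∈_)
open import Data.Product using (_×_)
open import Relation.Binary.PropositionalEquality using (_≡_)

-- Short partizan games as finite game trees: G = { G^L | G^R },
-- option sets represented as finite lists.
data Game : Set where
  ⟨_∣_⟩ : List Game → List Game → Game

leftOpts : Game → List Game
leftOpts ⟨ l ∣ r ⟩ = l

rightOpts : Game → List Game
rightOpts ⟨ l ∣ r ⟩ = r

𝟎 : Game
𝟎 = ⟨ [] ∣ [] ⟩

mutual
  _⊕_ : Game → Game → Game
  G@(⟨ gl ∣ gr ⟩) ⊕ H@(⟨ hl ∣ hr ⟩) =
    ⟨ sumL gl H ++ sumR G hl ∣ sumL gr H ++ sumR G hr ⟩

  sumL : List Game → Game → List Game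
  sumL [] H = []
  sumL (g ∷ gs) H = (g ⊕ H) ∷ sumL gs H

  sumR : Game → List Game → List Game
  sumR G [] = []
  sumR G (h ∷ hs) = (G ⊕ h) ∷ sumR G hs

mutual
  conj : Game → Game
  conj ⟨ l ∣ r ⟩ = ⟨ conjs r ∣ conjs l ⟩

  conjs : List Game → List Game
  conjs [] = []
  conjs (g ∷ gs) = conj g ∷ conjs gs

data Res : Set where
  L R : Res

data _≤ᵣ_ : Res → Res → Set where
  R≤R : R ≤ᵣ R
  R≤L : R ≤ᵣ L
  L≤L : L ≤ᵣ L

_⊔ᵣ_ : Res → Res → Res
L ⊔ᵣ _ = L
R ⊔ᵣ y = y

_⊓ᵣ_ : Res → Res → Res
R ⊓ᵣ _ = R
L ⊓ᵣ y = y

mutual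
  -- Left moves first; a player with no move on their turn wins (misère)
  oL : Game → Res
  oL ⟨ [] ∣ r ⟩ = L
  oL ⟨ g ∷ gs ∣ r ⟩ = maxOR (g ∷ gs)

  oR : Game → Res
  oR ⟨ l ∣ [] ⟩ = R
  oR ⟨ l ∣ g ∷ gs ⟩ = minOL (g ∷ gs)

  -- max over the list of o_R (nonempty lists only used; R is the unit of max)
  maxOR : List Game → Res
  maxOR [] = R
  maxOR (g ∷ gs) = oR g ⊔ᵣ maxOR gs

  -- min over the list of o_L (L is the unit of min)
  minOL : List Game → Res
  minOL [] = L
  minOL (g ∷ gs) = oL g ⊓ᵣ minOL gs

_≤ₒ_ : Game → Game → Set
G ≤ₒ H = (oL G ≤ᵣ oL H) × (oR G ≤ᵣ oR H)

data Follower : Game → Game → Set where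
  here  : ∀ {G} → Follower G G
  viaL  : ∀ {H G G'} → G' ∈ leftOpts G → Follower H G' → Follower H G
  viaR  : ∀ {H G G'} → G' ∈ rightOpts G → Follower H G' → Follower H G

LeftEnd : Game → Set
LeftEnd G = leftOpts G ≡ []

RightEnd : Game → Set
RightEnd G = rightOpts G ≡ []

DeadLeftEnd : Game → Set
DeadLeftEnd G = ∀ H → Follower H G → LeftEnd H

DeadRightEnd : Game → Set
DeadRightEnd G = ∀ H → Follower H G → RightEnd H

DeadEnding : Game → Set
DeadEnding G = ∀ H → Follower H G →
  (LeftEnd H → DeadLeftEnd H) × (RightEnd H → DeadRightEnd H)

_≥E_ : Game → Game → Set
G ≥E H = ∀ X → DeadEnding X → (H ⊕ X) ≤ₒ (G ⊕ X)

_≡E_ : Game → Game → Set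
G ≡E H = (G ≥E H) × (H ≥E G)

{-# OPTIONS --safe #-}

-- If conj B + D ≥ 0 then D ≥ B; applied to G + H ≥ 0 and to its conjugate this
-- gives both inequalities. To win D + Z, Left follows a winning strategy on B + Z,
-- consulting conj B + D ≥ 0: every Right move there has a Left reply to a game
-- that is again ≥ 0, since otherwise a separating context could be built.
-- This breaks down only when B + Z or D + Z is an end; then B, respectively D, is a
-- dead end, and dead ends cancel against their conjugates, by counting moves.
-- The reply is only shown not to be absent, which suffices as outcomes are decidable.
module Submission where

open import Defs
open import Algebra.Bundles using (CommutativeSemigroup)
open import Data.List using (List; []; _∷_; _++_)
open import Data.List.Membership.Propositional using (_∈_)
open import Data.List.Membership.Propositional.Properties using (∈-++⁻; ∈-++⁺ˡ; ∈-++⁺ʳ)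
open import Data.List.Relation.Unary.All using (All; []; _∷_)
open import Data.List.Relation.Unary.Any using (here; there)
open import Data.Nat using (ℕ; zero; suc; _+_; _≤_; _<_; s≤s)
open import Data.Nat.Induction using (<-wellFounded)
open import Data.Nat.Properties using
  (≤-trans; ≤-total; ≤-pred; <-trans; m≤m+n; m≤n+m; n≤1+n; m≤n⇒m≤1+n)
open import Data.Product using (_×_; _,_; ∃-syntax; proj₁; proj₂)
open import Data.Sum using (_⊎_; inj₁; inj₂)
open import Induction.WellFounded using (Acc; acc)
open import Level using (0ℓ)
open import Relation.Binary.PropositionalEquality
  using (_≡_; _≢_; refl; sym; trans; cong; cong₂; subst; subst₂)
open import Relation.Nullary using (¬_; contradiction)

-- Players and membership in option lists

opp : Res → Res
opp L = R
opp R = L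

-- `Res` doubles as the type of players, so that facts symmetric in Left and Right are proved once,
-- for a player `p`.
opts : Res → Game → List Game
opts L = leftOpts
opts R = rightOpts

nonempty : ∀ {xs : List Game} {x} → x ∈ xs → xs ≢ []
nonempty (here _) ()
nonempty (there _) ()

empty⊎member : (xs : List Game) → xs ≡ [] ⊎ (∃[ x ] x ∈ xs)
empty⊎member [] = inj₁ refl
empty⊎member (x ∷ xs) = inj₂ (x , here refl)

memberless⇒empty : (xs : List Game) → (∀ {x} → ¬ x ∈ xs) → xs ≡ []
memberless⇒empty [] _ = refl
memberless⇒empty (x ∷ xs) f = contradiction (here refl) f

-- Options of sums

∈-sumL⁻ : ∀ gs H {x} → x ∈ sumL gs H → ∃[ g ] (g ∈ gs × x ≡ g ⊕ H)
∈-sumL⁻ (g ∷ gs) H (here e) = g , here refl , e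
∈-sumL⁻ (g ∷ gs) H (there m) with ∈-sumL⁻ gs H m
... | g′ , m′ , e = g′ , there m′ , e

∈-sumL⁺ : ∀ {gs} H {g} → g ∈ gs → (g ⊕ H) ∈ sumL gs H
∈-sumL⁺ H (here refl) = here refl
∈-sumL⁺ H (there m) = there (∈-sumL⁺ H m)

∈-sumR⁻ : ∀ G hs {x} → x ∈ sumR G hs → ∃[ h ] (h ∈ hs × x ≡ G ⊕ h)
∈-sumR⁻ G (h ∷ hs) (here e) = h , here refl , e
∈-sumR⁻ G (h ∷ hs) (there m) with ∈-sumR⁻ G hs m
... | h′ , m′ , e = h′ , there m′ , e

∈-sumR⁺ : ∀ G {hs} {h} → h ∈ hs → (G ⊕ h) ∈ sumR G hs
∈-sumR⁺ G (here refl) = here refl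
∈-sumR⁺ G (there m) = there (∈-sumR⁺ G m)

opts-⊕ : ∀ p G H → opts p (G ⊕ H) ≡ sumL (opts p G) H ++ sumR G (opts p H)
opts-⊕ L ⟨ _ ∣ _ ⟩ ⟨ _ ∣ _ ⟩ = refl
opts-⊕ R ⟨ _ ∣ _ ⟩ ⟨ _ ∣ _ ⟩ = refl

data OptionOf⊕ (p : Res) (G H : Game) : Game → Set where
  inˡ : ∀ {g} → g ∈ opts p G → OptionOf⊕ p G H (g ⊕ H)
  inʳ : ∀ {h} → h ∈ opts p H → OptionOf⊕ p G H (G ⊕ h)

∈-⊕⁻ : ∀ p G H {x} → x ∈ opts p (G ⊕ H) → OptionOf⊕ p G H x
∈-⊕⁻ p G H m with ∈-++⁻ (sumL (opts p G) H) (subst (_ ∈_) (opts-⊕ p G H) m)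
... | inj₁ m₁ with ∈-sumL⁻ (opts p G) H m₁
...   | _ , g∈ , refl = inˡ g∈
∈-⊕⁻ p G H m | inj₂ m₂ with ∈-sumR⁻ G (opts p H) m₂
...   | _ , h∈ , refl = inʳ h∈

∈-⊕⁺ˡ : ∀ p G H {g} → g ∈ opts p G → (g ⊕ H) ∈ opts p (G ⊕ H)
∈-⊕⁺ˡ p G H m = subst (_ ∈_) (sym (opts-⊕ p G H)) (∈-++⁺ˡ (∈-sumL⁺ H m))

∈-⊕⁺ʳ : ∀ p G H {h} → h ∈ opts p H → (G ⊕ h) ∈ opts p (G ⊕ H)
∈-⊕⁺ʳ p G H m =
  subst (_ ∈_) (sym (opts-⊕ p G H)) (∈-++⁺ʳ (sumL (opts p G) H) (∈-sumR⁺ G m))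

⊕-end⁺ : ∀ p G H → opts p G ≡ [] → opts p H ≡ [] → opts p (G ⊕ H) ≡ []
⊕-end⁺ p G H eG eH = trans (opts-⊕ p G H) (cong₂ (λ gs hs → sumL gs H ++ sumR G hs) eG eH)

⊕-end⁻ : ∀ p G H → opts p (G ⊕ H) ≡ [] → opts p G ≡ [] × opts p H ≡ []
⊕-end⁻ p G H e =
  memberless⇒empty _ (λ m → nonempty (∈-⊕⁺ˡ p G H m) e) ,
  memberless⇒empty _ (λ m → nonempty (∈-⊕⁺ʳ p G H m) e)

mutual
  ⊕-identityˡ : ∀ X → 𝟎 ⊕ X ≡ X
  ⊕-identityˡ ⟨ l ∣ r ⟩ = cong₂ ⟨_∣_⟩ (sumR-identityˡ l) (sumR-identityˡ r)

  sumR-identityˡ : ∀ xs → sumR 𝟎 xs ≡ xs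
  sumR-identityˡ [] = refl
  sumR-identityˡ (x ∷ xs) = cong₂ _∷_ (⊕-identityˡ x) (sumR-identityˡ xs)

-- Conjugates

opts-conj : ∀ p G → opts p (conj G) ≡ conjs (opts (opp p) G)
opts-conj L ⟨ _ ∣ _ ⟩ = refl
opts-conj R ⟨ _ ∣ _ ⟩ = refl

∈-conjs⁻ : ∀ gs {x} → x ∈ conjs gs → ∃[ g ] (g ∈ gs × x ≡ conj g)
∈-conjs⁻ (g ∷ gs) (here e) = g , here refl , e
∈-conjs⁻ (g ∷ gs) (there m) with ∈-conjs⁻ gs m
... | g′ , m′ , e = g′ , there m′ , e

∈-conjs⁺ : ∀ {gs g} → g ∈ gs → conj g ∈ conjs gs
∈-conjs⁺ (here refl) = here refl
∈-conjs⁺ (there m) = there (∈-conjs⁺ m)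

∈-conj⁻ : ∀ p G {x} → x ∈ opts p (conj G) → ∃[ g ] (g ∈ opts (opp p) G × x ≡ conj g)
∈-conj⁻ p G m = ∈-conjs⁻ _ (subst (_ ∈_) (opts-conj p G) m)

∈-conj⁺ : ∀ p G {g} → g ∈ opts (opp p) G → conj g ∈ opts p (conj G)
∈-conj⁺ p G m = subst (_ ∈_) (sym (opts-conj p G)) (∈-conjs⁺ m)

conj-end : ∀ p G → opts (opp p) G ≡ [] → opts p (conj G) ≡ []
conj-end p G e = trans (opts-conj p G) (cong conjs e)

mutual
  conj-involutive : ∀ G → conj (conj G) ≡ G
  conj-involutive ⟨ l ∣ r ⟩ = cong₂ ⟨_∣_⟩ (conjs-involutive l) (conjs-involutive r)

  conjs-involutive : ∀ gs → conjs (conjs gs) ≡ gs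
  conjs-involutive [] = refl
  conjs-involutive (g ∷ gs) = cong₂ _∷_ (conj-involutive g) (conjs-involutive gs)

conjs-++ : ∀ xs ys → conjs (xs ++ ys) ≡ conjs xs ++ conjs ys
conjs-++ [] ys = refl
conjs-++ (x ∷ xs) ys = cong (conj x ∷_) (conjs-++ xs ys)

mutual
  conj-⊕ : ∀ G H → conj (G ⊕ H) ≡ conj G ⊕ conj H
  conj-⊕ G@(⟨ gl ∣ gr ⟩) H@(⟨ hl ∣ hr ⟩) = cong₂ ⟨_∣_⟩
    (trans (conjs-++ (sumL gr H) (sumR G hr)) (cong₂ _++_ (conjs-sumL gr H) (conjs-sumR G hr)))
    (trans (conjs-++ (sumL gl H) (sumR G hl)) (cong₂ _++_ (conjs-sumL gl H) (conjs-sumR G hl)))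

  conjs-sumL : ∀ gs H → conjs (sumL gs H) ≡ sumL (conjs gs) (conj H)
  conjs-sumL [] H = refl
  conjs-sumL (g ∷ gs) H = cong₂ _∷_ (conj-⊕ g H) (conjs-sumL gs H)

  conjs-sumR : ∀ G hs → conjs (sumR G hs) ≡ sumR (conj G) (conjs hs)
  conjs-sumR G [] = refl
  conjs-sumR G (h ∷ hs) = cong₂ _∷_ (conj-⊕ G h) (conjs-sumR G hs)

-- Outcomes

-- With only two results, an inequality can be proved by contradiction. This is where double
-- negations disappear.
≤ᵣ-intro : ∀ {a b} → (a ≡ L → ¬ b ≡ R) → a ≤ᵣ b
≤ᵣ-intro {L} {L} f = L≤L
≤ᵣ-intro {L} {R} f = contradiction refl (f refl)
≤ᵣ-intro {R} {L} f = R≤L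
≤ᵣ-intro {R} {R} f = R≤R

≤ᵣ-L : ∀ {a b} → a ≤ᵣ b → a ≡ L → b ≡ L
≤ᵣ-L L≤L _ = refl

opp-anti : ∀ {a b} → a ≤ᵣ b → opp b ≤ᵣ opp a
opp-anti R≤R = L≤L
opp-anti R≤L = R≤L
opp-anti L≤L = R≤R

opp-⊔ : ∀ a b → opp (a ⊔ᵣ b) ≡ opp a ⊓ᵣ opp b
opp-⊔ L b = refl
opp-⊔ R b = refl

opp-⊓ : ∀ a b → opp (a ⊓ᵣ b) ≡ opp a ⊔ᵣ opp b
opp-⊓ L b = refl
opp-⊓ R b = refl

mutual
  oL-conj : ∀ G → oL (conj G) ≡ opp (oR G)
  oL-conj ⟨ l ∣ [] ⟩ = refl
  oL-conj ⟨ l ∣ g ∷ gs ⟩ = maxOR-conjs (g ∷ gs)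

  oR-conj : ∀ G → oR (conj G) ≡ opp (oL G)
  oR-conj ⟨ [] ∣ r ⟩ = refl
  oR-conj ⟨ g ∷ gs ∣ r ⟩ = minOL-conjs (g ∷ gs)

  maxOR-conjs : ∀ gs → maxOR (conjs gs) ≡ opp (minOL gs)
  maxOR-conjs [] = refl
  maxOR-conjs (g ∷ gs) =
    trans (cong₂ _⊔ᵣ_ (oR-conj g) (maxOR-conjs gs)) (sym (opp-⊓ (oL g) (minOL gs)))

  minOL-conjs : ∀ gs → minOL (conjs gs) ≡ opp (maxOR gs)
  minOL-conjs [] = refl
  minOL-conjs (g ∷ gs) =
    trans (cong₂ _⊓ᵣ_ (oL-conj g) (minOL-conjs gs)) (sym (opp-⊔ (oR g) (maxOR gs)))

conj-anti : ∀ G H → G ≤ₒ H → conj H ≤ₒ conj G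
conj-anti G H (l , r) =
  subst₂ _≤ᵣ_ (sym (oL-conj H)) (sym (oL-conj G)) (opp-anti r) ,
  subst₂ _≤ᵣ_ (sym (oR-conj H)) (sym (oR-conj G)) (opp-anti l)

maxOR-R⁻ : ∀ gs → maxOR gs ≡ R → ∀ {g} → g ∈ gs → oR g ≡ R
maxOR-R⁻ (g ∷ gs) e m with oR g in eg
maxOR-R⁻ (g ∷ gs) e (here refl) | R = eg
maxOR-R⁻ (g ∷ gs) e (there m) | R = maxOR-R⁻ gs e m

maxOR-R⁺ : ∀ gs → (∀ {g} → g ∈ gs → oR g ≡ R) → maxOR gs ≡ R
maxOR-R⁺ [] f = refl
maxOR-R⁺ (g ∷ gs) f rewrite f (here refl) = maxOR-R⁺ gs (λ m → f (there m))

minOL-R⁻ : ∀ gs → minOL gs ≡ R → ∃[ g ] (g ∈ gs × oL g ≡ R)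
minOL-R⁻ (g ∷ gs) e with oL g in eg
... | R = g , here refl , eg
... | L with minOL-R⁻ gs e
...   | h , m , eh = h , there m , eh

minOL-R⁺ : ∀ {gs g} → g ∈ gs → oL g ≡ R → minOL gs ≡ R
minOL-R⁺ (here refl) e rewrite e = refl
minOL-R⁺ {h ∷ gs} (there m) e with oL h
... | R = refl
... | L = minOL-R⁺ m e

oL-R⁻ : ∀ G → oL G ≡ R → leftOpts G ≢ [] × (∀ {g} → g ∈ leftOpts G → oR g ≡ R)
oL-R⁻ ⟨ g ∷ gs ∣ r ⟩ e = (λ ()) , maxOR-R⁻ (g ∷ gs) e

oL-R⁺ : ∀ G → leftOpts G ≢ [] → (∀ {g} → g ∈ leftOpts G → oR g ≡ R) → oL G ≡ R
oL-R⁺ ⟨ [] ∣ r ⟩ ne f = contradiction refl ne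
oL-R⁺ ⟨ g ∷ gs ∣ r ⟩ ne f = maxOR-R⁺ (g ∷ gs) f

oR-R⁻ : ∀ G → oR G ≡ R → RightEnd G ⊎ (∃[ g ] (g ∈ rightOpts G × oL g ≡ R))
oR-R⁻ ⟨ l ∣ [] ⟩ e = inj₁ refl
oR-R⁻ ⟨ l ∣ g ∷ gs ⟩ e = inj₂ (minOL-R⁻ (g ∷ gs) e)

oR-end : ∀ G → RightEnd G → oR G ≡ R
oR-end ⟨ l ∣ [] ⟩ e = refl

oR-R⁺ : ∀ G {g} → g ∈ rightOpts G → oL g ≡ R → oR G ≡ R
oR-R⁺ ⟨ l ∣ g ∷ gs ⟩ m e = minOL-R⁺ m e

oL-end : ∀ G → LeftEnd G → oL G ≡ L
oL-end ⟨ [] ∣ r ⟩ e = refl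

≢R⇒≡L : ∀ {a} → a ≢ R → a ≡ L
≢R⇒≡L {L} _ = refl
≢R⇒≡L {R} f = contradiction refl f

≡L⇒≢R : ∀ {a} → a ≡ L → a ≢ R
≡L⇒≢R refl ()

oR-L⁻ : ∀ G → oR G ≡ L → ∀ {g} → g ∈ rightOpts G → oL g ≡ L
oR-L⁻ G e m = ≢R⇒≡L (λ e′ → ≡L⇒≢R e (oR-R⁺ G m e′))

oR-L⁺ : ∀ G {g} → g ∈ rightOpts G → (∀ {h} → h ∈ rightOpts G → oL h ≡ L) → oR G ≡ L
oR-L⁺ G m f = ≢R⇒≡L won
  where
  won : oR G ≢ R
  won e with oR-R⁻ G e
  ... | inj₁ end = nonempty m end
  ... | inj₂ (_ , m′ , e′) = ≡L⇒≢R (f m′) e′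

maxOR-L⁻ : ∀ gs → maxOR gs ≡ L → ∃[ g ] (g ∈ gs × oR g ≡ L)
maxOR-L⁻ (g ∷ gs) e with oR g in eg
... | L = g , here refl , eg
... | R with maxOR-L⁻ gs e
...   | h , m , eh = h , there m , eh

oL-L⁻ : ∀ G → oL G ≡ L → LeftEnd G ⊎ (∃[ g ] (g ∈ leftOpts G × oR g ≡ L))
oL-L⁻ ⟨ [] ∣ r ⟩ e = inj₁ refl
oL-L⁻ ⟨ g ∷ gs ∣ r ⟩ e = inj₂ (maxOR-L⁻ (g ∷ gs) e)

oL-L⁺ : ∀ G {g} → g ∈ leftOpts G → oR g ≡ L → oL G ≡ L
oL-L⁺ G m e = ≢R⇒≡L λ e′ → ≡L⇒≢R e (proj₂ (oL-R⁻ G e′) m)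

-- Sizes

mutual
  size : Game → ℕ
  size ⟨ l ∣ r ⟩ = suc (sizes l + sizes r)

  sizes : List Game → ℕ
  sizes [] = 0
  sizes (g ∷ gs) = size g + sizes gs

size≤sizes : ∀ {gs g} → g ∈ gs → size g ≤ sizes gs
size≤sizes {g ∷ gs} (here refl) = m≤m+n (size g) (sizes gs)
size≤sizes {g ∷ gs} (there m) = ≤-trans (size≤sizes m) (m≤n+m (sizes gs) (size g))

size< : ∀ p G {g} → g ∈ opts p G → size g < size G
size< L ⟨ l ∣ r ⟩ m = s≤s (≤-trans (size≤sizes m) (m≤m+n (sizes l) (sizes r)))
size< R ⟨ l ∣ r ⟩ m = s≤s (≤-trans (size≤sizes m) (m≤n+m (sizes r) (sizes l)))

-- Options reached through a membership proof are not structural subterms, so recursion descends on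
-- size. One accessibility proof per component lets any one of them shrink while the others stay.
AccSize : Game → Set
AccSize G = Acc _<_ (size G)

accSize : ∀ G → AccSize G
accSize G = <-wellFounded (size G)

-- Bisimilarity: equality of game trees with options taken as sets

infix 4 _≈_

data _≈_ (G H : Game) : Set where
  bisim : (∀ p {g} → g ∈ opts p G → ∃[ h ] (h ∈ opts p H × g ≈ h)) →
          (∀ p {h} → h ∈ opts p H → ∃[ g ] (g ∈ opts p G × g ≈ h)) → G ≈ H

≈-refl : ∀ {G} → G ≈ G
≈-refl {G} = go G (accSize G)
  where
  go : ∀ G → AccSize G → G ≈ G
  go G (acc rs) = bisim (λ p m → _ , m , go _ (rs (size< p G m)))
                        (λ p m → _ , m , go _ (rs (size< p G m)))

≈-sym : ∀ {G H} → G ≈ H → H ≈ G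
≈-sym {G} {H} (bisim f b) = bisim forth back
  where
  forth : ∀ p {h} → h ∈ opts p H → ∃[ g ] (g ∈ opts p G × h ≈ g)
  forth p m with b p m
  ... | g , m′ , e = g , m′ , ≈-sym e
  back : ∀ p {g} → g ∈ opts p G → ∃[ h ] (h ∈ opts p H × h ≈ g)
  back p m with f p m
  ... | h , m′ , e = h , m′ , ≈-sym e

≈-trans : ∀ {G H K} → G ≈ H → H ≈ K → G ≈ K
≈-trans {G} {H} {K} (bisim f b) (bisim f′ b′) = bisim forth back
  where
  forth : ∀ p {g} → g ∈ opts p G → ∃[ k ] (k ∈ opts p K × g ≈ k)
  forth p m with f p m
  ... | h , m′ , e with f′ p m′
  ...   | k , m″ , e′ = k , m″ , ≈-trans e e′
  back : ∀ p {k} → k ∈ opts p K → ∃[ g ] (g ∈ opts p G × g ≈ k)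
  back p m with b′ p m
  ... | h , m′ , e with b p m′
  ...   | g , m″ , e′ = g , m″ , ≈-trans e′ e

≈-end : ∀ p {G H} → G ≈ H → opts p G ≡ [] → opts p H ≡ []
≈-end p (bisim f b) e = memberless⇒empty _ λ m → nonempty (proj₁ (proj₂ (b p m))) e

mutual
  oL-R-resp-≈ : ∀ {G H} → G ≈ H → oL G ≡ R → oL H ≡ R
  oL-R-resp-≈ {G} {H} e@(bisim f b) w = oL-R⁺ H
    (λ end → proj₁ (oL-R⁻ G w) (≈-end L (≈-sym e) end)) opt
    where
    opt : ∀ {h} → h ∈ leftOpts H → oR h ≡ R
    opt m with b L m
    ... | g , m′ , e′ = oR-R-resp-≈ e′ (proj₂ (oL-R⁻ G w) m′)

  oR-R-resp-≈ : ∀ {G H} → G ≈ H → oR G ≡ R → oR H ≡ R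
  oR-R-resp-≈ {G} {H} e@(bisim f b) w with oR-R⁻ G w
  ... | inj₁ end = oR-end H (≈-end R e end)
  ... | inj₂ (g , m , w′) with f R m
  ...   | h , m′ , e′ = oR-R⁺ H m′ (oL-R-resp-≈ e′ w′)

oL-resp-≈ : ∀ {G H} → G ≈ H → oL G ≡ oL H
oL-resp-≈ {G} {H} e with oL G in eG | oL H in eH
... | L | L = refl
... | R | R = refl
... | L | R = trans (sym eG) (oL-R-resp-≈ (≈-sym e) eH)
... | R | L = trans (sym (oL-R-resp-≈ e eG)) eH

oR-resp-≈ : ∀ {G H} → G ≈ H → oR G ≡ oR H
oR-resp-≈ {G} {H} e with oR G in eG | oR H in eH
... | L | L = refl
... | R | R = refl
... | L | R = trans (sym eG) (oR-R-resp-≈ (≈-sym e) eH)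
... | R | L = trans (sym (oR-R-resp-≈ e eG)) eH

-- Laws of the disjunctive sum up to bisimilarity

⊕-comm : ∀ G H → G ⊕ H ≈ H ⊕ G
⊕-comm G H = go G H (accSize G) (accSize H)
  where
  go : ∀ G H → AccSize G → AccSize H → G ⊕ H ≈ H ⊕ G
  go G H aG@(acc rG) aH@(acc rH) = bisim forth back
    where
    forth : ∀ p {x} → x ∈ opts p (G ⊕ H) → ∃[ y ] (y ∈ opts p (H ⊕ G) × x ≈ y)
    forth p m with ∈-⊕⁻ p G H m
    ... | inˡ {g} g∈ = _ , ∈-⊕⁺ʳ p H G g∈ , go g H (rG (size< p G g∈)) aH
    ... | inʳ {h} h∈ = _ , ∈-⊕⁺ˡ p H G h∈ , go G h aG (rH (size< p H h∈))
    back : ∀ p {y} → y ∈ opts p (H ⊕ G) → ∃[ x ] (x ∈ opts p (G ⊕ H) × x ≈ y)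
    back p m with ∈-⊕⁻ p H G m
    ... | inˡ {h} h∈ = _ , ∈-⊕⁺ʳ p G H h∈ , go G h aG (rH (size< p H h∈))
    ... | inʳ {g} g∈ = _ , ∈-⊕⁺ˡ p G H g∈ , go g H (rG (size< p G g∈)) aH

⊕-assoc : ∀ G H K → (G ⊕ H) ⊕ K ≈ G ⊕ (H ⊕ K)
⊕-assoc G H K = go G H K (accSize G) (accSize H) (accSize K)
  where
  go : ∀ G H K → AccSize G → AccSize H → AccSize K → (G ⊕ H) ⊕ K ≈ G ⊕ (H ⊕ K)
  go G H K aG@(acc rG) aH@(acc rH) aK@(acc rK) = bisim forth back
    where
    forth : ∀ p {x} → x ∈ opts p ((G ⊕ H) ⊕ K) → ∃[ y ] (y ∈ opts p (G ⊕ (H ⊕ K)) × x ≈ y)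
    forth p m with ∈-⊕⁻ p (G ⊕ H) K m
    ... | inʳ k∈ =
      _ , ∈-⊕⁺ʳ p G _ (∈-⊕⁺ʳ p H K k∈) , go G H _ aG aH (rK (size< p K k∈))
    ... | inˡ m′ with ∈-⊕⁻ p G H m′
    ...   | inˡ g∈ = _ , ∈-⊕⁺ˡ p G _ g∈ , go _ H K (rG (size< p G g∈)) aH aK
    ...   | inʳ h∈ =
      _ , ∈-⊕⁺ʳ p G _ (∈-⊕⁺ˡ p H K h∈) , go G _ K aG (rH (size< p H h∈)) aK
    back : ∀ p {y} → y ∈ opts p (G ⊕ (H ⊕ K)) → ∃[ x ] (x ∈ opts p ((G ⊕ H) ⊕ K) × x ≈ y)
    back p m with ∈-⊕⁻ p G (H ⊕ K) m
    ... | inˡ g∈ =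
      _ , ∈-⊕⁺ˡ p _ K (∈-⊕⁺ˡ p G H g∈) , go _ H K (rG (size< p G g∈)) aH aK
    ... | inʳ m′ with ∈-⊕⁻ p H K m′
    ...   | inˡ h∈ =
      _ , ∈-⊕⁺ˡ p _ K (∈-⊕⁺ʳ p G H h∈) , go G _ K aG (rH (size< p H h∈)) aK
    ...   | inʳ k∈ = _ , ∈-⊕⁺ʳ p _ K k∈ , go G H _ aG aH (rK (size< p K k∈))

⊕-cong : ∀ {G G′ H H′} → G ≈ G′ → H ≈ H′ → G ⊕ H ≈ G′ ⊕ H′
⊕-cong {G} {G′} {H} {H′} e e′ = go e e′ (accSize G) (accSize H)
  where
  go : ∀ {G G′ H H′} → G ≈ G′ → H ≈ H′ → AccSize G → AccSize H → G ⊕ H ≈ G′ ⊕ H′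
  go {G} {G′} {H} {H′} e@(bisim f b) e′@(bisim f′ b′) aG@(acc rG) aH@(acc rH) = bisim forth back
    where
    forth : ∀ p {x} → x ∈ opts p (G ⊕ H) → ∃[ y ] (y ∈ opts p (G′ ⊕ H′) × x ≈ y)
    forth p m with ∈-⊕⁻ p G H m
    ... | inˡ g∈ =
      let _ , g′∈ , d = f p g∈ in
      _ , ∈-⊕⁺ˡ p G′ H′ g′∈ , go d e′ (rG (size< p G g∈)) aH
    ... | inʳ h∈ =
      let _ , h′∈ , d = f′ p h∈ in
      _ , ∈-⊕⁺ʳ p G′ H′ h′∈ , go e d aG (rH (size< p H h∈))
    back : ∀ p {y} → y ∈ opts p (G′ ⊕ H′) → ∃[ x ] (x ∈ opts p (G ⊕ H) × x ≈ y)
    back p m with ∈-⊕⁻ p G′ H′ m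
    ... | inˡ g′∈ =
      let _ , g∈ , d = b p g′∈ in
      _ , ∈-⊕⁺ˡ p G H g∈ , go d e′ (rG (size< p G g∈)) aH
    ... | inʳ h′∈ =
      let _ , h∈ , d = b′ p h′∈ in
      _ , ∈-⊕⁺ʳ p G H h∈ , go e d aG (rH (size< p H h∈))

⊕-commutativeSemigroup : CommutativeSemigroup 0ℓ 0ℓ
⊕-commutativeSemigroup = record
  { Carrier = Game ; _≈_ = _≈_ ; _∙_ = _⊕_
  ; isCommutativeSemigroup = record
    { isSemigroup = record
      { isMagma = record
        { isEquivalence = record { refl = ≈-refl ; sym = ≈-sym ; trans = ≈-trans }
        ; ∙-cong = ⊕-cong }
      ; assoc = ⊕-assoc }
    ; comm = ⊕-comm } }

open import Algebra.Properties.CommutativeSemigroup ⊕-commutativeSemigroup using (interchange)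

-- Dead-ending games

option-follower : ∀ p {G g} → g ∈ opts p G → Follower g G
option-follower L m = viaL m here
option-follower R m = viaR m here

follower-trans : ∀ {F G H} → Follower F G → Follower G H → Follower F H
follower-trans p here = p
follower-trans p (viaL m q) = viaL m (follower-trans p q)
follower-trans p (viaR m q) = viaR m (follower-trans p q)

deadEnding-option : ∀ p {G g} → DeadEnding G → g ∈ opts p G → DeadEnding g
deadEnding-option p d m H f = d H (follower-trans f (option-follower p m))

deadLeftEnd-option : ∀ p {G g} → DeadLeftEnd G → g ∈ opts p G → DeadLeftEnd g
deadLeftEnd-option p d m H f = d H (follower-trans f (option-follower p m))

end-follower : ∀ {G H} → LeftEnd G → RightEnd G → Follower H G → H ≡ G
end-follower eL eR here = refl
end-follower eL eR (viaL m _) = contradiction eL (nonempty m)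
end-follower eL eR (viaR m _) = contradiction eR (nonempty m)

-- A follower that is also a Right-end has no options at all, hence no follower but itself.
deadLeftEnd⇒deadEnding : ∀ {G} → DeadLeftEnd G → DeadEnding G
deadLeftEnd⇒deadEnding d H f =
  (λ _ K f′ → d K (follower-trans f′ f)) ,
  (λ eR K f′ → subst RightEnd (sym (end-follower (d H f) eR f′)) eR)

leftEnd⇒dead : ∀ {G} → DeadEnding G → LeftEnd G → DeadLeftEnd G
leftEnd⇒dead {G} d = proj₁ (d G here)

rightEnd⇒dead : ∀ {G} → DeadEnding G → RightEnd G → DeadRightEnd G
rightEnd⇒dead {G} d = proj₂ (d G here)

-- Both end conditions are vacuous at the root. The separating contexts are built with options on
-- both sides for this reason.
deadEnding-intro : ∀ {G} → leftOpts G ≢ [] → rightOpts G ≢ [] →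
  (∀ p {g} → g ∈ opts p G → DeadEnding g) → DeadEnding G
deadEnding-intro neL neR d H here =
  (λ e → contradiction e neL) , (λ e → contradiction e neR)
deadEnding-intro neL neR d H (viaL m f) = d L m H f
deadEnding-intro neL neR d H (viaR m f) = d R m H f

-- Closure of dead-ending games under sums and conjugates

data FollowerOf⊕ (G H : Game) : Game → Set where
  sum : ∀ {G′ H′} → Follower G′ G → Follower H′ H → FollowerOf⊕ G H (G′ ⊕ H′)

⊕-follower : ∀ {G H F} → Follower F (G ⊕ H) → FollowerOf⊕ G H F
⊕-follower f = go f refl
  where
  -- The sum is replaced by a variable `X` with an equation, so that the follower proof can be
  -- matched on.
  go : ∀ {G H X F} → Follower F X → X ≡ G ⊕ H → FollowerOf⊕ G H F
  step : ∀ p {G H x F} → x ∈ opts p (G ⊕ H) → Follower F x → FollowerOf⊕ G H F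
  go here refl = sum here here
  go (viaL m f) refl = step L m f
  go (viaR m f) refl = step R m f
  step p {G} {H} m f with ∈-⊕⁻ p G H m
  step p m f | inˡ g∈ with go f refl
  ... | sum f₁ f₂ = sum (follower-trans f₁ (option-follower p g∈)) f₂
  step p m f | inʳ h∈ with go f refl
  ... | sum f₁ f₂ = sum f₁ (follower-trans f₂ (option-follower p h∈))

⊕-deadLeftEnd : ∀ {G H} → DeadLeftEnd G → DeadLeftEnd H → DeadLeftEnd (G ⊕ H)
⊕-deadLeftEnd dG dH F f with ⊕-follower f
... | sum {G′} {H′} f₁ f₂ = ⊕-end⁺ L G′ H′ (dG G′ f₁) (dH H′ f₂)

⊕-deadRightEnd : ∀ {G H} → DeadRightEnd G → DeadRightEnd H → DeadRightEnd (G ⊕ H)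
⊕-deadRightEnd dG dH F f with ⊕-follower f
... | sum {G′} {H′} f₁ f₂ = ⊕-end⁺ R G′ H′ (dG G′ f₁) (dH H′ f₂)

⊕-deadEnding : ∀ {G H} → DeadEnding G → DeadEnding H → DeadEnding (G ⊕ H)
⊕-deadEnding dG dH F f with ⊕-follower f
... | sum {G′} {H′} f₁ f₂ =
  (λ e → let eG , eH = ⊕-end⁻ L G′ H′ e in
    ⊕-deadLeftEnd (proj₁ (dG G′ f₁) eG) (proj₁ (dH H′ f₂) eH)) ,
  (λ e → let eG , eH = ⊕-end⁻ R G′ H′ e in
    ⊕-deadRightEnd (proj₂ (dG G′ f₁) eG) (proj₂ (dH H′ f₂) eH))

conj-follower : ∀ {G F} → Follower F (conj G) → ∃[ F′ ] (Follower F′ G × F ≡ conj F′)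
conj-follower f = go f refl
  where
  go : ∀ {G X F} → Follower F X → X ≡ conj G → ∃[ F′ ] (Follower F′ G × F ≡ conj F′)
  go {G} here e = G , here , e
  go {G} (viaL m f) refl with ∈-conj⁻ L G m
  ... | g , g∈ , e with go f e
  ...   | F′ , f′ , e′ = F′ , viaR g∈ f′ , e′
  go {G} (viaR m f) refl with ∈-conj⁻ R G m
  ... | g , g∈ , e with go f e
  ...   | F′ , f′ , e′ = F′ , viaL g∈ f′ , e′

end-conj : ∀ p G → opts p (conj G) ≡ [] → opts (opp p) G ≡ []
end-conj p G e = memberless⇒empty _ λ m → nonempty (∈-conj⁺ p G m) e

conj-deadLeftEnd : ∀ {G} → DeadRightEnd G → DeadLeftEnd (conj G)
conj-deadLeftEnd d F f with conj-follower f
... | F′ , f′ , refl = conj-end L F′ (d F′ f′)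

conj-deadRightEnd : ∀ {G} → DeadLeftEnd G → DeadRightEnd (conj G)
conj-deadRightEnd d F f with conj-follower f
... | F′ , f′ , refl = conj-end R F′ (d F′ f′)

conj-deadEnding : ∀ {G} → DeadEnding G → DeadEnding (conj G)
conj-deadEnding d F f with conj-follower f
... | F′ , f′ , refl =
  (λ e → conj-deadLeftEnd (proj₂ (d F′ f′) (end-conj L F′ e))) ,
  (λ e → conj-deadRightEnd (proj₁ (d F′ f′) (end-conj R F′ e)))

𝟎-deadEnding : DeadEnding 𝟎
𝟎-deadEnding = deadLeftEnd⇒deadEnding λ { _ here → refl ; _ (viaL () _) ; _ (viaR () _) }

-- Separation

-- Left has n successive moves and Right none; in misère play these moves are a burden to Left.
integer : ℕ → Game
integer zero = 𝟎
integer (suc n) = ⟨ integer n ∷ [] ∣ [] ⟩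

integer-rightEnd : ∀ n → RightEnd (integer n)
integer-rightEnd zero = refl
integer-rightEnd (suc n) = refl

integer-follower : ∀ n {F} → Follower F (integer n) → ∃[ m ] F ≡ integer m
integer-follower n here = n , refl
integer-follower (suc n) (viaL (here refl) f) = integer-follower n f
integer-follower zero (viaL () _)
integer-follower zero (viaR () _)
integer-follower (suc n) (viaR () _)

integer-deadRightEnd : ∀ n → DeadRightEnd (integer n)
integer-deadRightEnd n F f with integer-follower n f
... | m , refl = integer-rightEnd m

integer-deadEnding : ∀ n → DeadEnding (integer n)
integer-deadEnding n F f with integer-follower n f
... | zero , refl = 𝟎-deadEnding 𝟎 here
... | suc m , refl = (λ ()) , (λ _ → integer-deadRightEnd (suc m))

-- Right runs out of moves in G before Left has exhausted a large integer.
mutual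
  oL-⊕-integer : ∀ n G → size G ≤ n → AccSize G → oL (G ⊕ integer n) ≡ R
  oL-⊕-integer zero ⟨ _ ∣ _ ⟩ () _
  oL-⊕-integer (suc n) G s (acc rs) =
    oL-R⁺ (G ⊕ integer (suc n)) (nonempty (∈-⊕⁺ʳ L G (integer (suc n)) (here refl))) opt
    where
    opt : ∀ {x} → x ∈ leftOpts (G ⊕ integer (suc n)) → oR x ≡ R
    opt m with ∈-⊕⁻ L G (integer (suc n)) m
    ... | inˡ g∈ = oR-⊕-integer (suc n) _
      (≤-trans (≤-trans (n≤1+n _) (size< L G g∈)) (m≤n⇒m≤1+n s)) (rs (size< L G g∈))
    -- Left has spent a move of the integer; the bound with Right to move is weaker by one to absorb
    -- this.
    ... | inʳ (here refl) = oR-⊕-integer n G s (acc rs)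

  oR-⊕-integer : ∀ n G → size G ≤ suc n → AccSize G → oR (G ⊕ integer n) ≡ R
  oR-⊕-integer n G s (acc rs) with empty⊎member (rightOpts G)
  ... | inj₁ end = oR-end (G ⊕ integer n) (⊕-end⁺ R G (integer n) end (integer-rightEnd n))
  ... | inj₂ (g , g∈) = oR-R⁺ (G ⊕ integer n) (∈-⊕⁺ˡ R G (integer n) g∈)
    (oL-⊕-integer n g (≤-pred (≤-trans (size< R G g∈) s)) (rs (size< R G g∈)))

-- A witness against `G ≥E 𝟎`. Recording only play with Left to start loses nothing, by
-- `Refuted-from-oR`.
Refuted : Game → Set
Refuted G = ∃[ X ] (DeadEnding X × oL X ≡ L × oL (G ⊕ X) ≡ R)

-- The context `Y` gives Left one move, to `X`, which wins in `Y` alone but loses in `G ⊕ Y`. If she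
-- moves in `G` instead, Right turns `Y` into an integer too long for what remains.
Refuted-from-oR : ∀ G {X} → DeadEnding X → oR X ≡ L → oR (G ⊕ X) ≡ R → Refuted G
Refuted-from-oR G {X} dX wX wGX = Y , dY , oL-L⁺ Y (here refl) wX ,
  oL-R⁺ (G ⊕ Y) (nonempty (∈-⊕⁺ʳ L G Y (here refl))) opt
  where
  N : Game
  N = integer (size G)
  Y : Game
  Y = ⟨ X ∷ [] ∣ N ∷ [] ⟩
  dY : DeadEnding Y
  dY = deadEnding-intro (λ ()) (λ ())
    λ { L (here refl) → dX ; R (here refl) → integer-deadEnding (size G) }
  opt : ∀ {x} → x ∈ leftOpts (G ⊕ Y) → oR x ≡ R
  opt m with ∈-⊕⁻ L G Y m
  ... | inʳ (here refl) = wGX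
  ... | inˡ {g} g∈ = oR-R⁺ (g ⊕ Y) (∈-⊕⁺ʳ R g Y (here refl))
    (oL-⊕-integer (size G) g (≤-trans (n≤1+n _) (size< L G g∈)) (accSize g))

¬Refuted⇒≥𝟎 : ∀ G → ¬ Refuted G → G ≥E 𝟎
¬Refuted⇒≥𝟎 G nr X dX rewrite ⊕-identityˡ X =
  ≤ᵣ-intro (λ w w′ → nr (X , dX , w , w′)) ,
  ≤ᵣ-intro (λ w w′ → nr (Refuted-from-oR G dX w w′))

-- Finiteness lets the double negations be collected one by one. It serves to choose refuters for
-- all options at once, each being known only not to be absent.
¬¬-All : ∀ {P : Game → Set} xs → (∀ {x} → x ∈ xs → ¬ ¬ P x) → ¬ ¬ All P xs
¬¬-All [] f k = k []
¬¬-All (x ∷ xs) f k =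
  f (here refl) λ px → ¬¬-All xs (λ m → f (there m)) λ pxs → k (px ∷ pxs)

refuters : ∀ {gs} → All Refuted gs → List Game
refuters [] = []
refuters ((X , _) ∷ rs) = X ∷ refuters rs

refuters-sound : ∀ {gs} (rs : All Refuted gs) {x} → x ∈ refuters rs → DeadEnding x × oL x ≡ L
refuters-sound ((_ , d , w , _) ∷ rs) (here refl) = d , w
refuters-sound (_ ∷ rs) (there m) = refuters-sound rs m

refuters-complete : ∀ {gs} (rs : All Refuted gs) {g} → g ∈ gs →
  ∃[ X ] (X ∈ refuters rs × oL (g ⊕ X) ≡ R)
refuters-complete ((X , _ , _ , w) ∷ rs) (here refl) = X , here refl , w
refuters-complete (_ ∷ rs) (there m) with refuters-complete rs m
... | X , X∈ , w = X , there X∈ , w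

-- In the context Y Right wins by moving W to V: Left's move to some U is answered by
-- the refuter of U, and her only move in Y leaves an integer too long for V.
¬All-Refuted : ∀ W {V} → W ≥E 𝟎 → V ∈ rightOpts W → ¬ All Refuted (leftOpts V)
¬All-Refuted W {V} ge V∈ rs =
  ≡L⇒≢R (≤ᵣ-L (subst (λ Z → oR Z ≤ᵣ oR (W ⊕ Y)) (⊕-identityˡ Y) (proj₂ (ge Y dY))) oRY)
    (oR-R⁺ (W ⊕ Y) (∈-⊕⁺ˡ R W Y V∈)
      (oL-R⁺ (V ⊕ Y) (nonempty (∈-⊕⁺ʳ L V Y (here refl))) opt))
  where
  Y : Game
  -- The option `𝟎` keeps `Y` from being a Right-end when there are no refuters; it is harmless
  -- because Left, to move in `𝟎`, wins.
  Y = ⟨ integer (size V) ∷ [] ∣ 𝟎 ∷ refuters rs ⟩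
  dY : DeadEnding Y
  dY = deadEnding-intro (λ ()) (λ ()) λ
    { L (here refl) → integer-deadEnding (size V)
    ; R (here refl) → 𝟎-deadEnding
    ; R (there m) → proj₁ (refuters-sound rs m) }
  oRY : oR Y ≡ L
  oRY = oR-L⁺ Y (here refl) λ { (here refl) → refl ; (there m) → proj₂ (refuters-sound rs m) }
  opt : ∀ {x} → x ∈ leftOpts (V ⊕ Y) → oR x ≡ R
  opt m with ∈-⊕⁻ L V Y m
  ... | inʳ (here refl) = oR-⊕-integer (size V) V (n≤1+n _) (accSize V)
  ... | inˡ {U} U∈ with refuters-complete rs U∈
  ...   | X , X∈ , w = oR-R⁺ (U ⊕ Y) (∈-⊕⁺ʳ R U Y (there X∈)) w

-- An option that is not `≥E 𝟎` cannot lack a refuter, so if all options failed, `¬All-Refuted`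
-- would be contradicted.
left-reply : ∀ W {V} → W ≥E 𝟎 → V ∈ rightOpts W → ¬ (∀ {U} → U ∈ leftOpts V → ¬ U ≥E 𝟎)
left-reply W ge V∈ no =
  ¬¬-All _ (λ {U} U∈ nr → no U∈ (¬Refuted⇒≥𝟎 U nr)) (¬All-Refuted W ge V∈)

-- Dead ends cancel against their conjugates

-- Together with `LeftLasts` this sets up a race of solitary runs: Right chooses his fastest way out
-- of moves, while `LeftLasts` bounds every run of Left from below.
data RightCanEndWithin : ℕ → Game → Set where
  ended : ∀ {n G} → RightEnd G → RightCanEndWithin n G
  move  : ∀ {n G g} → g ∈ rightOpts G → RightCanEndWithin n g → RightCanEndWithin (suc n) G

data LeftLasts : ℕ → Game → Set where
  none : ∀ {G} → LeftLasts 0 G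
  more : ∀ {n G} → leftOpts G ≢ [] → (∀ {g} → g ∈ leftOpts G → LeftLasts n g) → LeftLasts (suc n) G

leftLasts-≤ : ∀ {m n G} → m ≤ n → LeftLasts n G → LeftLasts m G
leftLasts-≤ {zero} _ _ = none
leftLasts-≤ {suc m} (s≤s m≤n) (more ne f) = more ne λ g∈ → leftLasts-≤ m≤n (f g∈)

leftLasts-⊕ : ∀ {n} G X → LeftLasts n G → LeftLasts n (G ⊕ X)
leftLasts-⊕ G X none = none
leftLasts-⊕ {suc n} G X l@(more ne f) = more (λ e → ne (proj₁ (⊕-end⁻ L G X e))) opt
  where
  opt : ∀ {x} → x ∈ leftOpts (G ⊕ X) → LeftLasts n x
  opt m with ∈-⊕⁻ L G X m
  ... | inˡ {g} g∈ = leftLasts-⊕ g X (f g∈)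
  -- A move in `X` leaves `G` untouched, so one unit of its count is given away.
  ... | inʳ {x} x∈ = leftLasts-⊕ G x (leftLasts-≤ (n≤1+n n) l)

-- Take the least of the numbers: it is attained by some `g`, and `Q` weakens to it everywhere.
quickest : ∀ {P Q : ℕ → Game → Set} → (∀ {m n g} → m ≤ n → Q n g → Q m g) →
  ∀ x xs → (∀ {g} → g ∈ x ∷ xs → ∃[ n ] (P n g × Q n g)) →
  ∃[ n ] ((∃[ g ] (g ∈ x ∷ xs × P n g)) × (∀ {g} → g ∈ x ∷ xs → Q n g))
quickest mono x [] f with f (here refl)
... | n , p , q = n , (x , here refl , p) , λ { (here refl) → q }
quickest mono x (y ∷ ys) f with f (here refl) | quickest mono y ys (λ m → f (there m))
... | n , p , q | k , (g , g∈ , pg) , qs with ≤-total n k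
...   | inj₁ n≤k = n , (x , here refl , p) ,
  λ { (here refl) → q ; (there m) → mono n≤k (qs m) }
...   | inj₂ k≤n = k , (g , there g∈ , pg) ,
  λ { (here refl) → mono k≤n q ; (there m) → qs m }

-- The number is the length of Right's shortest run in `K`; in the mirror image no run of Left is
-- shorter.
rightRace : ∀ K → AccSize K → ∃[ n ] (RightCanEndWithin n K × LeftLasts n (conj K))
rightRace ⟨ l ∣ [] ⟩ _ = 0 , ended refl , none
rightRace K@(⟨ l ∣ k ∷ ks ⟩) (acc rs)
  with quickest {RightCanEndWithin} {λ n g → LeftLasts n (conj g)} leftLasts-≤ k ks
         (λ {g} g∈ → rightRace g (rs (size< R K g∈)))
... | n , (g , g∈ , p) , q = suc n , move g∈ p , more (λ ()) opt
  where
  opt : ∀ {x} → x ∈ leftOpts (conj K) → LeftLasts n x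
  opt m with ∈-conj⁻ L K m
  ... | g , g∈ , refl = q g∈

-- Right can move only in `K` and Left only in `A`. Since Right starts, equal counts suffice: after
-- n rounds it is his turn and he has no move.
countdown : ∀ {n} K A → DeadLeftEnd K → DeadRightEnd A →
  RightCanEndWithin n K → LeftLasts n A → oR (K ⊕ A) ≡ R
countdown K A dK dA (ended e) _ = oR-end (K ⊕ A) (⊕-end⁺ R K A e (dA A here))
countdown K A dK dA (move {g = k} k∈ p) (more ne f) =
  oR-R⁺ (K ⊕ A) (∈-⊕⁺ˡ R K A k∈) (oL-R⁺ (k ⊕ A) (λ e → ne (proj₂ (⊕-end⁻ L k A e))) opt)
  where
  dk : DeadLeftEnd k
  dk = deadLeftEnd-option R dK k∈
  opt : ∀ {x} → x ∈ leftOpts (k ⊕ A) → oR x ≡ R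
  opt m with ∈-⊕⁻ L k A m
  ... | inˡ k′∈ = contradiction (dk k here) (nonempty k′∈)
  ... | inʳ {a} a∈ = countdown k a dk (λ H h → dA H (viaL a∈ h)) p (f a∈)

mutual
  -- Right keeps his strategy on `X` and answers a move in `conj K` by its mirror image in `K`,
  -- where Left has no moves.
  oL-R-⊕-deadLeftEnd : ∀ K X → DeadLeftEnd K → DeadEnding X → AccSize K → AccSize X →
    oL X ≡ R → oL (K ⊕ (conj K ⊕ X)) ≡ R
  oL-R-⊕-deadLeftEnd K X dK dX aK@(acc rK) aX@(acc rX) w =
    oL-R⁺ (K ⊕ (conj K ⊕ X)) ne opt
    where
    ne : leftOpts (K ⊕ (conj K ⊕ X)) ≢ []
    ne e = proj₁ (oL-R⁻ X w) (proj₂ (⊕-end⁻ L (conj K) X (proj₂ (⊕-end⁻ L K (conj K ⊕ X) e))))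
    opt : ∀ {x} → x ∈ leftOpts (K ⊕ (conj K ⊕ X)) → oR x ≡ R
    opt m with ∈-⊕⁻ L K (conj K ⊕ X) m
    ... | inˡ k∈ = contradiction (dK K here) (nonempty k∈)
    ... | inʳ m′ with ∈-⊕⁻ L (conj K) X m′
    ...   | inʳ {x} x∈ = oR-R-⊕-deadLeftEnd K x dK (deadEnding-option L dX x∈) aK
      (rX (size< L X x∈)) (proj₂ (oL-R⁻ X w) x∈)
    ...   | inˡ k̄∈ with ∈-conj⁻ L K k̄∈
    ...     | k , k∈ , refl = oR-R⁺ (K ⊕ (conj k ⊕ X)) (∈-⊕⁺ˡ R K (conj k ⊕ X) k∈)
      (oL-R-⊕-deadLeftEnd k X (deadLeftEnd-option R dK k∈) dX (rK (size< R K k∈)) aX w)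

  oR-R-⊕-deadLeftEnd : ∀ K X → DeadLeftEnd K → DeadEnding X → AccSize K → AccSize X →
    oR X ≡ R → oR (K ⊕ (conj K ⊕ X)) ≡ R
  oR-R-⊕-deadLeftEnd K X dK dX aK aX@(acc rX) w with oR-R⁻ X w
  ... | inj₂ (x , x∈ , w′) = oR-R⁺ (K ⊕ (conj K ⊕ X)) (∈-⊕⁺ʳ R K (conj K ⊕ X) (∈-⊕⁺ʳ R (conj K) X x∈))
    (oL-R-⊕-deadLeftEnd K x dK (deadEnding-option R dX x∈) aK (rX (size< R X x∈)) w′)
  -- Right has no moves left in `X`, hence none ever again, and must play on in `K`; the race
  -- decides.
  ... | inj₁ end with rightRace K aK
  ...   | n , p , q = countdown K (conj K ⊕ X) dK
    (⊕-deadRightEnd (conj-deadRightEnd dK) (rightEnd⇒dead dX end)) p (leftLasts-⊕ (conj K) X q)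

-- Transferring wins along conj B ⊕ D ≥ 𝟎

regroup : ∀ A D K Z → (A ⊕ D) ⊕ (K ⊕ Z) ≈ K ⊕ (A ⊕ (D ⊕ Z))
regroup A D K Z = ≈-trans (interchange A D K Z)
  (≈-trans (⊕-cong (⊕-comm A K) ≈-refl) (⊕-assoc K A (D ⊕ Z)))

≥𝟎-oL : ∀ W {X} → W ≥E 𝟎 → DeadLeftEnd X → oL (W ⊕ X) ≡ L
≥𝟎-oL W {X} ge dX = ≤ᵣ-L (proj₁ (ge X (deadLeftEnd⇒deadEnding dX)))
  (trans (cong oL (⊕-identityˡ X)) (oL-end X (dX X here)))

≥𝟎-comm : ∀ G H → (G ⊕ H) ≥E 𝟎 → (H ⊕ G) ≥E 𝟎
≥𝟎-comm G H ge X dX =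
  subst (oL (𝟎 ⊕ X) ≤ᵣ_) (oL-resp-≈ e) (proj₁ (ge X dX)) ,
  subst (oR (𝟎 ⊕ X) ≤ᵣ_) (oR-resp-≈ e) (proj₂ (ge X dX))
  where
  e : (G ⊕ H) ⊕ X ≈ (H ⊕ G) ⊕ X
  e = ⊕-cong (⊕-comm G H) ≈-refl

-- Take the context `B ⊕ Z`, a Left-end: Left, to move, wins `(conj B ⊕ D) ⊕ (B ⊕ Z)`. But `B`
-- cancels `conj B`, so a Right win on `D ⊕ Z` would carry over to that sum.
transfer-leftEnd : ∀ B D Z → DeadLeftEnd B → DeadEnding D → DeadLeftEnd Z →
  (conj B ⊕ D) ≥E 𝟎 → oL (D ⊕ Z) ≢ R
transfer-leftEnd B D Z dB dD dZ ge w =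
  ≡L⇒≢R (≥𝟎-oL (conj B ⊕ D) ge (⊕-deadLeftEnd dB dZ))
    (oL-R-resp-≈ (≈-sym (regroup (conj B) D B Z))
      (oL-R-⊕-deadLeftEnd B (D ⊕ Z) dB (⊕-deadEnding dD (deadLeftEnd⇒deadEnding dZ))
        (accSize B) (accSize (D ⊕ Z)) w))

-- Conjugation exchanges the players and the roles of `B` and `D`, which reduces this to
-- `transfer-leftEnd`.
transfer-rightEnd : ∀ B D Z → DeadEnding B → DeadRightEnd D → DeadRightEnd Z →
  (conj B ⊕ D) ≥E 𝟎 → oR (B ⊕ Z) ≢ L
transfer-rightEnd B D Z dB dD dZ ge w =
  transfer-leftEnd (conj D) (conj B) (conj Z) (conj-deadLeftEnd dD) (conj-deadEnding dB)
    (conj-deadLeftEnd dZ) ge′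
    (trans (cong oL (sym (conj-⊕ B Z))) (trans (oL-conj (B ⊕ Z)) (cong opp w)))
  where
  ge′ : (conj (conj D) ⊕ conj B) ≥E 𝟎
  ge′ = subst (λ G → (G ⊕ conj B) ≥E 𝟎) (sym (conj-involutive D)) (≥𝟎-comm (conj B) D ge)

mutual
  -- Left's winning move in `Z` is copied. A winning move in `B` is read as a Right move in
  -- `conj B ⊕ D`, and the reply there tells how to continue. Some component shrinks at each call
  -- and none grows.
  transferL : ∀ B D Z → DeadEnding B → DeadEnding D → DeadEnding Z →
    AccSize B → AccSize D → AccSize Z →
    (conj B ⊕ D) ≥E 𝟎 → oL (B ⊕ Z) ≡ L → oL (D ⊕ Z) ≢ R
  transferL B D Z dB dD dZ aB@(acc rB) aD@(acc rD) aZ@(acc rZ) ge w w′ with oL-L⁻ (B ⊕ Z) w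
  ... | inj₁ end =
    let eB , eZ = ⊕-end⁻ L B Z end in
    transfer-leftEnd B D Z (leftEnd⇒dead dB eB) dD (leftEnd⇒dead dZ eZ) ge w′
  ... | inj₂ (_ , m , v) with ∈-⊕⁻ L B Z m
  ...   | inʳ {z} z∈ =
    transferR B D z dB dD (deadEnding-option L dZ z∈) aB aD (rZ (size< L Z z∈))
      ge v (proj₂ (oL-R⁻ (D ⊕ Z) w′) (∈-⊕⁺ʳ L D Z z∈))
  ...   | inˡ {b} b∈ = left-reply (conj B ⊕ D) ge (∈-⊕⁺ˡ R (conj B) D (∈-conj⁺ R B b∈)) no
    where
    no : ∀ {U} → U ∈ leftOpts (conj b ⊕ D) → ¬ U ≥E 𝟎
    no U∈ ge′ with ∈-⊕⁻ L (conj b) D U∈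
    ... | inʳ {d} d∈ =
      transferR b d Z (deadEnding-option L dB b∈) (deadEnding-option L dD d∈) dZ
        (rB (size< L B b∈)) (rD (size< L D d∈)) aZ
        ge′ v (proj₂ (oL-R⁻ (D ⊕ Z) w′) (∈-⊕⁺ˡ L D Z d∈))
    -- A reply in `conj b` stands for a Right move from `b` to `b′`: Left's strategy on `B ⊕ Z` is
    -- advanced by both moves while `D ⊕ Z` stays as it is.
    ... | inˡ b̄∈ with ∈-conj⁻ L b b̄∈
    ...   | b′ , b′∈ , refl =
      transferL b′ D Z (deadEnding-option R (deadEnding-option L dB b∈) b′∈) dD dZ
        (rB (<-trans (size< R b b′∈) (size< L B b∈))) aD aZ
        ge′ (oR-L⁻ (b ⊕ Z) v (∈-⊕⁺ˡ R b Z b′∈)) w′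

  -- Here Right's move in `D` is the one consulted in `conj B ⊕ D`. A reply in `d` is played at
  -- once; a reply in `conj B` is an imagined Right move in `B`, after which Left is to move in both
  -- sums.
  transferR : ∀ B D Z → DeadEnding B → DeadEnding D → DeadEnding Z →
    AccSize B → AccSize D → AccSize Z →
    (conj B ⊕ D) ≥E 𝟎 → oR (B ⊕ Z) ≡ L → oR (D ⊕ Z) ≢ R
  transferR B D Z dB dD dZ aB@(acc rB) aD@(acc rD) aZ@(acc rZ) ge w w′ with oR-R⁻ (D ⊕ Z) w′
  ... | inj₁ end =
    let eD , eZ = ⊕-end⁻ R D Z end in
    transfer-rightEnd B D Z dB (rightEnd⇒dead dD eD) (rightEnd⇒dead dZ eZ) ge w
  ... | inj₂ (_ , m , v) with ∈-⊕⁻ R D Z m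
  ...   | inʳ {z} z∈ =
    transferL B D z dB dD (deadEnding-option R dZ z∈) aB aD (rZ (size< R Z z∈))
      ge (oR-L⁻ (B ⊕ Z) w (∈-⊕⁺ʳ R B Z z∈)) v
  ...   | inˡ {d} d∈ = left-reply (conj B ⊕ D) ge (∈-⊕⁺ʳ R (conj B) D d∈) no
    where
    no : ∀ {U} → U ∈ leftOpts (conj B ⊕ d) → ¬ U ≥E 𝟎
    no U∈ ge′ with ∈-⊕⁻ L (conj B) d U∈
    ... | inʳ {d′} d′∈ =
      transferR B d′ Z dB (deadEnding-option L (deadEnding-option R dD d∈) d′∈) dZ
        aB (rD (<-trans (size< L d d′∈) (size< R D d∈))) aZ
        ge′ w (proj₂ (oL-R⁻ (d ⊕ Z) v) (∈-⊕⁺ˡ L d Z d′∈))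
    ... | inˡ b̄∈ with ∈-conj⁻ L B b̄∈
    ...   | b , b∈ , refl =
      transferL b d Z (deadEnding-option R dB b∈) (deadEnding-option R dD d∈) dZ
        (rB (size< R B b∈)) (rD (size< R D d∈)) aZ
        ge′ (oR-L⁻ (B ⊕ Z) w (∈-⊕⁺ˡ R B Z b∈)) v

-- The conjugate property

conj-⊕-≥𝟎⇒≥ : ∀ {B D} → DeadEnding B → DeadEnding D → (conj B ⊕ D) ≥E 𝟎 → D ≥E B
conj-⊕-≥𝟎⇒≥ {B} {D} dB dD ge Z dZ =
  ≤ᵣ-intro (transferL B D Z dB dD dZ (accSize B) (accSize D) (accSize Z) ge) ,
  ≤ᵣ-intro (transferR B D Z dB dD dZ (accSize B) (accSize D) (accSize Z) ge)

-- Conjugation reverses the order of outcomes and preserves dead-ending contexts, so `W` can be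
-- tested against `conj X`.
conj-≤𝟎 : ∀ W → 𝟎 ≥E W → conj W ≥E 𝟎
conj-≤𝟎 W le X dX =
  subst₂ _≤ₒ_ (conj-⊕-conj 𝟎) (conj-⊕-conj W)
    (conj-anti (W ⊕ conj X) (𝟎 ⊕ conj X) (le (conj X) (conj-deadEnding dX)))
  where
  conj-⊕-conj : ∀ G → conj (G ⊕ conj X) ≡ conj G ⊕ X
  conj-⊕-conj G = trans (conj-⊕ G (conj X)) (cong (conj G ⊕_) (conj-involutive X))

mainTheorem14 : ∀ G H → DeadEnding G → DeadEnding H →
    (G ⊕ H) ≡E 𝟎 → H ≡E conj G
mainTheorem14 G H dG dH (ge , le) =
  conj-⊕-≥𝟎⇒≥ (conj-deadEnding dG) dH
    (subst (λ K → (K ⊕ H) ≥E 𝟎) (sym (conj-involutive G)) ge) ,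
  -- The other half of the hypothesis, conjugated, says `conj G ⊕ conj H` is `≥E 𝟎`; now `H` plays
  -- the part of `B`.
  conj-⊕-≥𝟎⇒≥ dH (conj-deadEnding dG)
    (≥𝟎-comm (conj G) (conj H) (subst (_≥E 𝟎) (conj-⊕ G H) (conj-≤𝟎 (G ⊕ H) le)))
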